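{- There exists an absolute constant $C>0$ such that for all integers $d\ge 1$ and $\Delta\ge 2$, every $d$-degenerate graph $G$ of maximum degree $\Delta$ satisfies $\chi'_{\mathrm{inj}}(G)\le C\, d^3\log \Delta$. (That is, $\chi'_{\mathrm{inj}}(G)=O(d^3\log\Delta)$.)
   Context: All graphs are finite and simple. An injective edge-coloring of a graph $G$ is a function $\psi:E(G)\to\mathbb N$ such that whenever $\psi(e)=\psi(e')$ for distinct edges $e,e'$, no third edge of $G$ (distinct from $e$ and $e'$) joins an endpoint of $e$ to an endpoint of $e'$. The injective chromatic index $\chi'_{\mathrm{inj}}(G)$ is the minimum $k$ such that $G$ has an injective edge-coloring with colors in $\{1,\dots,k\}$. A graph is $d$-degenerate if every subgraph has a vertex of degree at most $d$. $\log$ denotes the natural logarithm. -}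

module Defs where

open import Data.Nat using (ℕ; zero; suc; _+_; _≤_; _<_)
open import Data.Bool using (Bool; true; false)
open import Data.Fin using (Fin)
import Data.Fin as F
open import Data.Product using (Σ; _×_; ∃)
open import Data.Sum using (_⊎_)
open import Relation.Binary.PropositionalEquality using (_≡_)
open import Relation.Nullary using (¬_)

count : ∀ {n} → (Fin n → Bool) → ℕ
count {zero}  p = 0
count {suc n} p with p F.zero
... | true  = suc (count (λ i → p (F.suc i)))
... | false = count (λ i → p (F.suc i))

record Graph : Set where
  field
    n     : ℕ
    adj   : Fin n → Fin n → Bool
    sym   : ∀ u v → adj u v ≡ adj v u
    irrefl : ∀ v → adj v v ≡ false

open Graph public

Adj : (G : Graph) → Fin (n G) → Fin (n G) → Set
Adj G u v = adj G u v ≡ true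

degree : (G : Graph) → Fin (n G) → ℕ
degree G v = count (adj G v)

MaxDegree : Graph → ℕ → Set
MaxDegree G Δ = (∀ v → degree G v ≤ Δ) × ∃ λ v → degree G v ≡ Δ

record Subgraph (G : Graph) : Set where
  field
    S    : Fin (n G) → Bool
    E    : Fin (n G) → Fin (n G) → Bool
    Esym : ∀ u v → E u v ≡ E v u
    E⊆G  : ∀ u v → E u v ≡ true → adj G u v ≡ true
    E⊆S  : ∀ u v → E u v ≡ true → S u ≡ true

subDegree : {G : Graph} → Subgraph G → Fin (n G) → ℕ
subDegree H v = count (Subgraph.E H v)

Degenerate : ℕ → Graph → Set
Degenerate d G = (H : Subgraph G) → ∃ (λ v → Subgraph.S H v ≡ true) →
  ∃ λ v → Subgraph.S H v ≡ true × subDegree H v ≤ d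

SameEdge : ∀ {m} → Fin m → Fin m → Fin m → Fin m → Set
SameEdge u v x y = (u ≡ x × v ≡ y) ⊎ (u ≡ y × v ≡ x)

Endpoint : ∀ {m} → Fin m → Fin m → Fin m → Set
Endpoint a u v = a ≡ u ⊎ a ≡ v

-- ψ assigns a colour to each edge (ψ u v = ψ v u); injectivity condition:
-- if distinct edges e = uv, e' = xy get the same colour, then no third edge ab
-- (distinct from e and e') joins an endpoint a of e to an endpoint b of e'.
IsInjectiveEdgeColoring : (G : Graph) → (Fin (n G) → Fin (n G) → ℕ) → Set
IsInjectiveEdgeColoring G ψ =
  (∀ u v → Adj G u v → ψ u v ≡ ψ v u) ×
  (∀ u v x y a b → Adj G u v → Adj G x y → ¬ SameEdge u v x y →
     ψ u v ≡ ψ x y → Endpoint a u v → Endpoint b x y → Adj G a b →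
     SameEdge a b u v ⊎ SameEdge a b x y)

InjChromIndexAtMost : Graph → ℕ → Set
InjChromIndexAtMost G k = Σ (Fin (n G) → Fin (n G) → ℕ) λ ψ →
  IsInjectiveEdgeColoring G ψ ×
  (∀ u v → Adj G u v → 1 ≤ ψ u v × ψ u v ≤ k)

-- Orient every edge along a degeneracy ordering, so that out-degrees are at most d, and give
-- each vertex u a word W u of length s = O(d² log Δ) over an alphabet of O(d) letters. A vertex has
-- at most d + Δ + d Δ others that are adjacent to it or share an in-neighbour with it, so a greedy
-- derandomised choice (potential: sum of 2^agreement) makes such words agree in few positions.
-- The edge v → u receives the colour (i , W u i) for a position i = I v u chosen greedily in
-- the order. Two edges v → u, x → y in conflict are joined in one of three ways: head to head, by
-- u → y, or tail to head, by v → y, and then the letters of W u and W y at i must differ; or by an edge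
-- from v or u to x, and then i must differ from I x y. These conditions exclude fewer than s positions.

module Submission where

open import Defs hiding (sym)
open import Data.Nat using (ℕ; zero; suc; _+_; _*_; _^_; _≤_; _<_; z≤n; s≤s; NonZero; >-nonZero; _≤?_; _<?_)
open import Data.Nat.Logarithm using (⌊log₂_⌋; ⌊log₂⌋-mono-≤; ⌊log₂[2^n]⌋≡n)
open import Data.Product using (Σ; _×_; ∃; _,_; proj₁; proj₂)

open import Algebra.Properties.CommutativeSemigroup using (x∙yz≈y∙xz)
open import Data.Bool using (Bool; true; false; _∧_; not; if_then_else_)
import Data.Bool.Properties as Bool
open import Data.Fin using (Fin; zero; suc; toℕ; _≟_; combine)
open import Data.Fin.Properties using (toℕ-injective; toℕ<n; any?; combine-injective)
open import Data.Nat.Properties hiding (_≟_)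
open import Data.Nat.Tactic.RingSolver using (solve-∀)
import Data.Sum as Sum
open import Data.Sum using (_⊎_; inj₁; inj₂)
open import Data.Vec.Functional using (_∷_)
open import Function using (_∘_)
open import Relation.Binary using (tri<; tri≈; tri>)
open import Relation.Binary.PropositionalEquality
  using (_≡_; _≢_; refl; sym; trans; cong; cong₂; subst)
open import Relation.Nullary using (Dec; does; yes; no; ¬_; contradiction)
open import Relation.Nullary.Decidable using (dec-true; dec-false)
open import Algebra.Properties.Semiring.Sum +-*-semiring
  using (sum; sum-syntax; sum-cong-≗; ∑-distrib-+; ∑-comm; *-distribˡ-sum; *-distribʳ-sum)

-- Indicator sums and averaging.

⟦_⟧ : Bool → ℕ
⟦ true  ⟧ = 1
⟦ false ⟧ = 0

count≡sum : ∀ {n} (p : Fin n → Bool) → count p ≡ ∑[ i < n ] ⟦ p i ⟧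
count≡sum {zero}  p = refl
count≡sum {suc n} p with p zero
... | true  = cong suc (count≡sum (p ∘ suc))
... | false = count≡sum (p ∘ suc)

sum-mono : ∀ {n} {f g : Fin n → ℕ} → (∀ i → f i ≤ g i) → sum f ≤ sum g
sum-mono {zero}  f≤g = z≤n
sum-mono {suc n} f≤g = +-mono-≤ (f≤g zero) (sum-mono (f≤g ∘ suc))

term≤sum : ∀ {n} (f : Fin n → ℕ) i → f i ≤ sum f
term≤sum f zero    = m≤m+n _ _
term≤sum f (suc i) = ≤-trans (term≤sum (f ∘ suc) i) (m≤n+m _ (f zero))

sum-zero : ∀ n → ∑[ i < n ] 0 ≡ 0
sum-zero zero    = refl
sum-zero (suc n) = sum-zero n

sum-indicator : ∀ {n} (i : Fin n) → ∑[ j < n ] ⟦ does (j ≟ i) ⟧ ≡ 1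
sum-indicator {suc n} zero    = cong suc (sum-zero n)
sum-indicator {suc n} (suc i) = sum-indicator i

-- Induction keeps the smaller of the head and the candidate from the tail. Multiplying out by the
-- number of terms avoids division.
∃-below-average : ∀ {n} (f : Fin (suc n) → ℕ) → ∃ λ i → suc n * f i ≤ sum f
∃-below-average {zero}  f = zero , ≤-refl
∃-below-average {suc n} f with ∃-below-average (f ∘ suc)
... | i , below with f zero ≤? f (suc i)
...   | yes f₀≤fᵢ = zero , +-monoʳ-≤ (f zero) (≤-trans (*-monoʳ-≤ (suc n) f₀≤fᵢ) below)
...   | no  f₀≰fᵢ = suc i , +-mono-≤ (<⇒≤ (≰⇒> f₀≰fᵢ)) below

-- Serves as a union bound: if `f i` counts the constraints that choice `i` violates and the total
-- is below the number of choices, some choice violates none.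
∃-zero : ∀ {n} (f : Fin n → ℕ) → sum f < n → ∃ λ i → f i ≡ 0
∃-zero {suc n} f sum<n with ∃-below-average f
... | i , below with f i in eq
...   | zero  = i , eq
...   | suc k = contradiction (≤-<-trans below sum<n) (≤⇒≯ (m≤m*n (suc n) (suc k)))

-- Words with few agreements, by a weighted potential.

agreement : ∀ {q s} → (Fin s → Fin q) → (Fin s → Fin q) → ℕ
agreement {s = s} w w′ = ∑[ i < s ] ⟦ does (w i ≟ w′ i) ⟧

does-≟-sym : ∀ {q} (i j : Fin q) → does (i ≟ j) ≡ does (j ≟ i)
does-≟-sym i j with i ≟ j
... | yes i≡j = sym (dec-true (j ≟ i) (sym i≡j))
... | no  i≢j = sym (dec-false (j ≟ i) (i≢j ∘ sym))

agreement-sym : ∀ {q s} (w w′ : Fin s → Fin q) → agreement w w′ ≡ agreement w′ w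
agreement-sym w w′ = sum-cong-≗ λ i → cong ⟦_⟧ (does-≟-sym (w i) (w′ i))

-- On {0, 1} the power of two is linear, `2 ^ b = 1 + b`, so the potential can be averaged over
-- letters.
*-2^⟦⟧ : ∀ a b → a * 2 ^ ⟦ b ⟧ ≡ a + a * ⟦ b ⟧
*-2^⟦⟧ a true  = *-suc a 1
*-2^⟦⟧ a false = trans (*-identityʳ a) (sym (trans (cong (a +_) (*-zeroʳ a)) (+-identityʳ a)))

-- Each `l j` equals exactly one letter, so the weights matched by the `suc q` letters add up to
-- `sum a`. A letter of at most average matched weight multiplies the potential by at most 1 + 1/(q
-- + 1).
∃-letter : ∀ {q n} (a : Fin n → ℕ) (l : Fin n → Fin (suc q)) → ∃ λ c →
  suc q * ∑[ j < n ] (a j * 2 ^ ⟦ does (c ≟ l j) ⟧) ≤ suc (suc q) * sum a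
∃-letter {q} {n} a l = c , (begin
  suc q * ∑[ j < n ] (a j * 2 ^ δ c j)         ≡⟨ cong (suc q *_) (sum-cong-≗ λ j → *-2^⟦⟧ (a j) (does (c ≟ l j))) ⟩
  suc q * ∑[ j < n ] (a j + a j * δ c j)       ≡⟨ cong (suc q *_) (∑-distrib-+ a (λ j → a j * δ c j)) ⟩
  suc q * (sum a + weight c)                   ≡⟨ *-distribˡ-+ (suc q) (sum a) (weight c) ⟩
  suc q * sum a + suc q * weight c             ≤⟨ +-monoʳ-≤ (suc q * sum a) below ⟩
  suc q * sum a + sum weight                   ≡⟨ cong (suc q * sum a +_) total ⟩
  suc q * sum a + sum a                        ≡⟨ +-comm (suc q * sum a) (sum a) ⟩
  suc (suc q) * sum a                          ∎)
  where
  open ≤-Reasoning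
  δ : Fin (suc q) → Fin n → ℕ
  δ c j = ⟦ does (c ≟ l j) ⟧
  weight : Fin (suc q) → ℕ
  weight c = ∑[ j < n ] (a j * δ c j)
  c     = proj₁ (∃-below-average weight)
  below = proj₂ (∃-below-average weight)
  total : sum weight ≡ sum a
  total = begin-equality
    ∑[ c < suc q ] ∑[ j < n ] (a j * δ c j)  ≡⟨ ∑-comm (λ c j → a j * δ c j) ⟩
    ∑[ j < n ] ∑[ c < suc q ] (a j * δ c j)  ≡⟨ sum-cong-≗ (λ j → sym (*-distribˡ-sum (a j) (λ c → δ c j))) ⟩
    ∑[ j < n ] (a j * ∑[ c < suc q ] δ c j)  ≡⟨ sum-cong-≗ (λ j → cong (a j *_) (sum-indicator (l j))) ⟩
    ∑[ j < n ] (a j * 1)                     ≡⟨ sum-cong-≗ (λ j → *-identityʳ (a j)) ⟩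
    sum a                                    ∎

-- The method of conditional expectations: letters are fixed one at a time, and each agreement is
-- absorbed into the weights as a factor 2 before the next letter is chosen.
∃-word : ∀ {q n} s (a : Fin n → ℕ) (f : Fin n → Fin s → Fin (suc q)) → ∃ λ w →
  suc q ^ s * ∑[ j < n ] (a j * 2 ^ agreement w (f j)) ≤ suc (suc q) ^ s * sum a
∃-word zero a f = (λ ()) , ≤-reflexive (cong (1 *_) (sum-cong-≗ λ j → *-identityʳ (a j)))
∃-word {q} {n} (suc s) a f with ∃-letter a (λ j → f j zero)
... | c , letter with ∃-word s (λ j → a j * 2 ^ ⟦ does (c ≟ f j zero) ⟧) (λ j → f j ∘ suc)
...   | w , word = c ∷ w , (begin
  suc q ^ suc s * ∑[ j < n ] (a j * 2 ^ (δ j + agreement w (f j ∘ suc)))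
    ≡⟨ cong (suc q ^ suc s *_) (sum-cong-≗ λ j →
         trans (cong (a j *_) (^-distribˡ-+-* 2 (δ j) _)) (sym (*-assoc (a j) _ _))) ⟩
  suc q * suc q ^ s * ∑[ j < n ] (a′ j * 2 ^ agreement w (f j ∘ suc))
    ≡⟨ *-assoc (suc q) (suc q ^ s) _ ⟩
  suc q * (suc q ^ s * ∑[ j < n ] (a′ j * 2 ^ agreement w (f j ∘ suc)))
    ≤⟨ *-monoʳ-≤ (suc q) word ⟩
  suc q * (suc (suc q) ^ s * sum a′)
    ≡⟨ x∙yz≈y∙xz *-commutativeSemigroup (suc q) (suc (suc q) ^ s) (sum a′) ⟩
  suc (suc q) ^ s * (suc q * sum a′)
    ≤⟨ *-monoʳ-≤ (suc (suc q) ^ s) letter ⟩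
  suc (suc q) ^ s * (suc (suc q) * sum a)
    ≡⟨ sym (trans (cong (_* sum a) (*-comm (suc (suc q)) (suc (suc q) ^ s))) (*-assoc (suc (suc q) ^ s) _ _)) ⟩
  suc (suc q) ^ suc s * sum a ∎)
  where
  open ≤-Reasoning
  δ a′ : Fin n → ℕ
  δ j = ⟦ does (c ≟ f j zero) ⟧
  a′ j = a j * 2 ^ δ j

-- In the form (1 + 1/k)^j ≤ k / (k - j), with k = j + i.
bernoulli : ∀ j i → suc (j + i) ^ j * i ≤ (j + i) ^ j * (j + i)
bernoulli j i = go j i (j + i) refl
  where
  open ≤-Reasoning
  -- `k` is kept as a separate variable because the induction trades `j` for `i` while their sum
  -- stays fixed.
  go : ∀ j i k → j + i ≡ k → suc k ^ j * i ≤ k ^ j * k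
  go zero    i k refl = ≤-refl
  go (suc j) i k eq = begin
    suc k * suc k ^ j * i     ≡⟨ lemma₁ (suc k) (suc k ^ j) i ⟩
    suc k ^ j * (suc k * i)   ≤⟨ *-monoʳ-≤ (suc k ^ j) bound ⟩
    suc k ^ j * (k * suc i)   ≡⟨ lemma₂ (suc k ^ j) k i ⟩
    k * (suc k ^ j * suc i)   ≤⟨ *-monoʳ-≤ k (go j (suc i) k (trans (+-suc j i) eq)) ⟩
    k * (k ^ j * k)           ≡⟨ sym (*-assoc k (k ^ j) k) ⟩
    k * k ^ j * k             ∎
    where
    lemma₁ : ∀ x y z → x * y * z ≡ y * (x * z)
    lemma₁ = solve-∀
    lemma₂ : ∀ x y z → x * (y * suc z) ≡ y * (x * suc z)
    lemma₂ = solve-∀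
    bound : suc k * i ≤ k * suc i
    bound = begin
      i + k * i   ≤⟨ +-monoˡ-≤ (k * i) (m+n≤o⇒n≤o (suc j) (≤-reflexive eq)) ⟩
      k + k * i   ≡⟨ sym (*-suc k i) ⟩
      k * suc i   ∎

-- The case `j = i = m` of `bernoulli`, that is (1 + 1/(2m))^m ≤ 2. With `m + m` letters, `m`
-- positions thus at most double the potential.
doubling : ∀ m .{{_ : NonZero m}} → suc (m + m) ^ m ≤ 2 * (m + m) ^ m
doubling m = *-cancelʳ-≤ _ _ m (begin
  suc (m + m) ^ m * m      ≤⟨ bernoulli m m ⟩
  (m + m) ^ m * (m + m)    ≡⟨ lemma ((m + m) ^ m) m ⟩
  2 * (m + m) ^ m * m      ∎)
  where
  open ≤-Reasoning
  lemma : ∀ x y → x * (y + y) ≡ 2 * x * y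
  lemma = solve-∀

^-distribʳ-* : ∀ x y t → (x * y) ^ t ≡ x ^ t * y ^ t
^-distribʳ-* x y zero    = refl
^-distribʳ-* x y (suc t) = trans (cong (x * y *_) (^-distribʳ-* x y t)) ([m*n]*[o*p]≡[m*o]*[n*p] x y (x ^ t) (y ^ t))

doubling-^ : ∀ m t .{{_ : NonZero m}} → suc (m + m) ^ (m * t) ≤ 2 ^ t * (m + m) ^ (m * t)
doubling-^ m t = begin
  suc (m + m) ^ (m * t)         ≡⟨ sym (^-*-assoc (suc (m + m)) m t) ⟩
  (suc (m + m) ^ m) ^ t         ≤⟨ ^-monoˡ-≤ t (doubling m) ⟩
  (2 * (m + m) ^ m) ^ t         ≡⟨ ^-distribʳ-* 2 ((m + m) ^ m) t ⟩
  2 ^ t * ((m + m) ^ m) ^ t     ≡⟨ cong (2 ^ t *_) (^-*-assoc (m + m) m t) ⟩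
  2 ^ t * (m + m) ^ (m * t)     ∎
  where open ≤-Reasoning

-- The `m * t` positions form `t` blocks of `m`, each costing a factor 2, so the final potential is
-- at most `2 ^ t * sum a`. It dominates each single term of positive weight.
∃-word-few-agreements : ∀ {n} m t .{{_ : NonZero m}} (a : Fin n → ℕ) (f : Fin n → Fin (m * t) → Fin (m + m)) →
  ∃ λ w → ∀ j → 1 ≤ a j → 2 ^ agreement w (f j) ≤ 2 ^ t * sum a
∃-word-few-agreements {n} m@(suc m′) t a f = w , λ j 1≤aⱼ → begin
  2 ^ agreement w (f j)                            ≤⟨ m≤n*m _ (a j) {{>-nonZero 1≤aⱼ}} ⟩
  a j * 2 ^ agreement w (f j)                      ≤⟨ term≤sum (λ j → a j * 2 ^ agreement w (f j)) j ⟩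
  ∑[ j < n ] (a j * 2 ^ agreement w (f j))         ≤⟨ potential ⟩
  2 ^ t * sum a                                    ∎
  where
  open ≤-Reasoning
  w = proj₁ (∃-word (m * t) a f)
  potential : ∑[ j < n ] (a j * 2 ^ agreement w (f j)) ≤ 2 ^ t * sum a
  potential = *-cancelˡ-≤ ((m + m) ^ (m * t)) {{m^n≢0 (m + m) (m * t)}} (begin
    (m + m) ^ (m * t) * ∑[ j < n ] (a j * 2 ^ agreement w (f j))  ≤⟨ proj₂ (∃-word (m * t) a f) ⟩
    suc (m + m) ^ (m * t) * sum a                ≤⟨ *-monoˡ-≤ (sum a) (doubling-^ m t) ⟩
    2 ^ t * (m + m) ^ (m * t) * sum a            ≡⟨ lemma (2 ^ t) ((m + m) ^ (m * t)) (sum a) ⟩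
    (m + m) ^ (m * t) * (2 ^ t * sum a)          ∎)
    where
    lemma : ∀ x y z → x * y * z ≡ y * (x * z)
    lemma = solve-∀

-- Boolean reflection and counting.

does-true⇒ : ∀ {P : Set} (p? : Dec P) → does p? ≡ true → P
does-true⇒ (yes p) _ = p

∧-true⇒ : ∀ a b → a ∧ b ≡ true → a ≡ true × b ≡ true
∧-true⇒ true true _ = refl , refl

≢true⇒≡false : ∀ b → b ≢ true → b ≡ false
≢true⇒≡false true  ≢ = contradiction refl ≢
≢true⇒≡false false _ = refl

⟦⟧-true : ∀ {b} → b ≡ true → 1 ≤ ⟦ b ⟧
⟦⟧-true refl = ≤-refl

⟦⟧-mono : ∀ a b → (a ≡ true → b ≡ true) → ⟦ a ⟧ ≤ ⟦ b ⟧
⟦⟧-mono false b a⇒b = z≤n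
⟦⟧-mono true  b a⇒b = ⟦⟧-true (a⇒b refl)

count-mono : ∀ {n} (p q : Fin n → Bool) → (∀ i → p i ≡ true → q i ≡ true) → count p ≤ count q
count-mono p q p⇒q rewrite count≡sum p | count≡sum q = sum-mono λ i → ⟦⟧-mono (p i) (q i) (p⇒q i)

count-positive : ∀ {n} (p : Fin n → Bool) i → p i ≡ true → 1 ≤ count p
count-positive p i pᵢ rewrite count≡sum p = ≤-trans (⟦⟧-true pᵢ) (term≤sum (⟦_⟧ ∘ p) i)

delete : ∀ {n} → (Fin n → Bool) → Fin n → Fin n → Bool
delete S v u = S u ∧ not (does (u ≟ v))

count-delete : ∀ {n} (S : Fin n → Bool) v → S v ≡ true → suc (count (delete S v)) ≤ count S
count-delete {n} S v v∈S = begin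
  suc (count (delete S v))                                     ≡⟨ cong suc (count≡sum (delete S v)) ⟩
  1 + ∑[ u < n ] ⟦ delete S v u ⟧                              ≡⟨ cong (_+ ∑[ u < n ] ⟦ delete S v u ⟧) (sym (sum-indicator v)) ⟩
  ∑[ u < n ] ⟦ does (u ≟ v) ⟧ + ∑[ u < n ] ⟦ delete S v u ⟧    ≡⟨ sym (∑-distrib-+ (λ u → ⟦ does (u ≟ v) ⟧) _) ⟩
  ∑[ u < n ] (⟦ does (u ≟ v) ⟧ + ⟦ delete S v u ⟧)             ≤⟨ sum-mono pointwise ⟩
  ∑[ u < n ] ⟦ S u ⟧                                           ≡⟨ sym (count≡sum S) ⟩
  count S                                                      ∎
  where
  open ≤-Reasoning
  pointwise : ∀ u → ⟦ does (u ≟ v) ⟧ + ⟦ delete S v u ⟧ ≤ ⟦ S u ⟧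
  pointwise u with u ≟ v
  ... | yes refl rewrite v∈S = ≤-refl
  ... | no  _    with S u
  ...   | true  = ≤-refl
  ...   | false = z≤n

-- Degeneracy orderings and recursion along a rank.

induced : (G : Graph) → (Fin (n G) → Bool) → Subgraph G
induced G S = record
  { S    = S
  ; E    = λ u v → (S u ∧ S v) ∧ adj G u v
  ; Esym = λ u v → cong₂ _∧_ (Bool.∧-comm (S u) (S v)) (Graph.sym G u v)
  ; E⊆G  = λ u v e → proj₂ (∧-true⇒ (S u ∧ S v) _ e)
  ; E⊆S  = λ u v e → proj₁ (∧-true⇒ (S u) _ (proj₁ (∧-true⇒ (S u ∧ S v) _ e)))
  }

module _ {d} (G : Graph) (degenerate : Degenerate d G) where

  -- Out-neighbourhoods enter only through their subsets p, so that updating r needs no Boolean rewriting.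
  record IsOrdering (k : ℕ) (S : Fin (n G) → Bool) (r : Fin (n G) → ℕ) : Set where
    field
      bounded   : ∀ v → S v ≡ true → r v < k
      injective : ∀ u v → S u ≡ true → S v ≡ true → r u ≡ r v → u ≡ v
      outdegree : ∀ v → S v ≡ true → (p : Fin (n G) → Bool) →
                  (∀ u → p u ≡ true → S u ≡ true × Adj G v u × r u < r v) → count p ≤ d

  -- Degeneracy of the subgraph induced on `S` yields a vertex `v` with at most `d` neighbours in
  -- `S`. It receives the top rank `k`, and the remaining vertices are ordered below it by
  -- induction.
  ordering-on : ∀ k S → count S ≤ k → ∃ (IsOrdering k S)
  ordering-on k S |S|≤k with any? (λ v → S v Bool.≟ true)
  ... | no S-empty = (λ _ → 0) , record
    { bounded   = λ v v∈S → contradiction (v , v∈S) S-empty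
    ; injective = λ u v u∈S → contradiction (u , u∈S) S-empty
    ; outdegree = λ v v∈S → contradiction (v , v∈S) S-empty
    }
  ordering-on zero    S |S|≤k | yes (v , v∈S) = contradiction (≤-trans (count-positive S v v∈S) |S|≤k) λ ()
  ordering-on (suc k) S |S|≤k | yes S-inhabited
    with degenerate (induced G S) S-inhabited
  ... | v , v∈S , deg≤d with ordering-on k (delete S v) (≤-pred (≤-trans (count-delete S v v∈S) |S|≤k))
  ...   | r , r-ord = r′ , record { bounded = bounded′ ; injective = injective′ ; outdegree = outdegree′ }
    where
    open IsOrdering r-ord
    r′ : Fin (n G) → ℕ
    r′ u = if does (u ≟ v) then k else r u

    r′-v : r′ v ≡ k
    r′-v rewrite dec-true (v ≟ v) refl = refl

    r′-other : ∀ {u} → u ≢ v → r′ u ≡ r u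
    r′-other {u} u≢v rewrite dec-false (u ≟ v) u≢v = refl

    remains : ∀ {u} → S u ≡ true → u ≢ v → delete S v u ≡ true
    remains {u} u∈S u≢v rewrite dec-false (u ≟ v) u≢v | u∈S = refl

    bounded′ : ∀ u → S u ≡ true → r′ u < suc k
    bounded′ u u∈S with u ≟ v
    ... | yes refl = ≤-refl
    ... | no  u≢v  = m<n⇒m<1+n (bounded u (remains u∈S u≢v))

    injective′ : ∀ u w → S u ≡ true → S w ≡ true → r′ u ≡ r′ w → u ≡ w
    injective′ u w u∈S w∈S eq with u ≟ v | w ≟ v
    ... | yes refl | yes refl = refl
    ... | yes refl | no  w≢v  = contradiction (sym eq) (<⇒≢ (bounded w (remains w∈S w≢v)))
    ... | no  u≢v  | yes refl = contradiction eq (<⇒≢ (bounded u (remains u∈S u≢v)))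
    ... | no  u≢v  | no  w≢v  = injective u w (remains u∈S u≢v) (remains w∈S w≢v) eq

    outdegree′ : ∀ w → S w ≡ true → (p : Fin (n G) → Bool) →
                 (∀ u → p u ≡ true → S u ≡ true × Adj G w u × r′ u < r′ w) → count p ≤ d
    outdegree′ w w∈S p p⊆out with w ≟ v
    -- The out-neighbours of the top vertex are among its neighbours in the induced subgraph.
    ... | yes refl = ≤-trans (count-mono p _ λ u u∈p → edge (proj₁ (p⊆out u u∈p)) (proj₁ (proj₂ (p⊆out u u∈p)))) deg≤d
      where
      edge : ∀ {u} → S u ≡ true → adj G w u ≡ true → (S w ∧ S u) ∧ adj G w u ≡ true
      edge u∈S wu rewrite w∈S | u∈S | wu = refl
    -- The top vertex is no out-neighbour of `w`, so the set `p` already lies in `delete S v`.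
    ... | no w≢v = outdegree w (remains w∈S w≢v) p λ u u∈p →
        let u∈S , wu , u<w = p⊆out u u∈p
            u≢v = λ { refl → <-asym (bounded w (remains w∈S w≢v)) (subst (_< r w) r′-v u<w) }
        in remains u∈S u≢v , wu , subst (_< r w) (r′-other u≢v) u<w

-- Stage k + 1 reassigns every vertex of rank at least k, so the values of ranks below k are final from stage k on.
greedy : ∀ {n} {T : Set} (r : Fin n → ℕ) (P : Fin n → (Fin n → T) → T → Set) → T →
  (∀ v g → ∃ (P v g)) →
  ∃ λ (F : Fin n → T) → ∀ v → ∃ λ g → (∀ u → r u < r v → g u ≡ F u) × P v g (F v)
greedy {n} {T} r P t₀ step = F , λ v → stage (r v) , (λ u → stage-stable) , chosen v
  where
  stage : ℕ → Fin n → T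
  stage zero    v = t₀
  stage (suc k) v with r v <? k
  ... | yes _ = stage k v
  ... | no  _ = proj₁ (step v (stage k))
  F : Fin n → T
  F v = stage (suc (r v)) v
  stage-suc : ∀ {k v} → r v < k → stage (suc k) v ≡ stage k v
  stage-suc {k} {v} r<k with r v <? k
  ... | yes _ = refl
  ... | no ¬r<k = contradiction r<k ¬r<k
  stage-stable : ∀ {k v} → r v < k → stage k v ≡ F v
  stage-stable {suc k} {v} r<1+k with m≤n⇒m<n∨m≡n (≤-pred r<1+k)
  ... | inj₁ r<k  = trans (stage-suc r<k) (stage-stable r<k)
  ... | inj₂ refl = refl
  chosen : ∀ v → P v (stage (r v)) (F v)
  chosen v with r v <? r v
  ... | yes r<r = contradiction r<r (<-irrefl refl)
  ... | no  _   = proj₂ (step v (stage (r v)))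

-- Words for all vertices at once.

m+m≢0 : ∀ m .{{_ : NonZero m}} → NonZero (m + m)
m+m≢0 (suc m) = _

first : ∀ n .{{_ : NonZero n}} → Fin n
first (suc n) = zero

-- Words are chosen in the order of the indices. Each pair is settled when its later member is
-- chosen; symmetry of `a` and of `agreement` covers the other order.
∃-words-few-agreements : ∀ {n} m t K .{{_ : NonZero m}} (a : Fin n → Fin n → ℕ) →
  (∀ u v → a u v ≡ a v u) → (∀ v → sum (a v) ≤ K) →
  ∃ λ (W : Fin n → Fin (m * t) → Fin (m + m)) →
    ∀ u v → u ≢ v → 1 ≤ a u v → 2 ^ agreement (W u) (W v) ≤ 2 ^ t * K
∃-words-few-agreements {n} m t K a a-sym a≤K =
  let W , few = greedy toℕ P (λ _ → first (m + m) {{m+m≢0 m}}) λ v g → ∃-word-few-agreements m t (a v) g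
  in W , bound W few
  where
  Word : Set
  Word = Fin (m * t) → Fin (m + m)
  P : Fin n → (Fin n → Word) → Word → Set
  -- The bound is imposed against every current word `g j`, including those replaced later. It is
  -- used for smaller indices, where `g` already equals `W`.
  P v g w = ∀ j → 1 ≤ a v j → 2 ^ agreement w (g j) ≤ 2 ^ t * sum (a v)
  module _ (W : Fin n → Word) (few : ∀ v → ∃ λ g → (∀ u → toℕ u < toℕ v → g u ≡ W u) × P v g (W v)) where
    later : ∀ u v → toℕ u < toℕ v → 1 ≤ a v u → 2 ^ agreement (W v) (W u) ≤ 2 ^ t * K
    later u v u<v 1≤a =
      let g , g≡W , few-v = few v
      in subst (λ w → 2 ^ agreement (W v) w ≤ 2 ^ t * K) (g≡W u u<v)
           (≤-trans (few-v u 1≤a) (*-monoʳ-≤ (2 ^ t) (a≤K v)))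
    bound : ∀ u v → u ≢ v → 1 ≤ a u v → 2 ^ agreement (W u) (W v) ≤ 2 ^ t * K
    bound u v u≢v 1≤a with <-cmp (toℕ u) (toℕ v)
    ... | tri≈ _ eq _  = contradiction (toℕ-injective eq) u≢v
    ... | tri> _ _ v<u = later v u v<u 1≤a
    ... | tri< u<v _ _ = subst (λ x → 2 ^ x ≤ 2 ^ t * K) (agreement-sym (W v) (W u))
                           (later u v u<v (subst (1 ≤_) (a-sym u v) 1≤a))

-- Choosing a position for each edge.

-- At most `d + d` vertices `b` matter for an edge from `v` to `u`. Each excludes at most `A`
-- positions by agreement with `W u` and at most `d` by the positions on its own out-edges, fewer
-- than `s` in total.
positions : ∀ {n s q} d A (out : Fin n → Fin n → Bool) (r : Fin n → ℕ) (W : Fin n → Fin s → Fin q) →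
  (∀ v u → out v u ≡ true → r u < r v) →
  (∀ v → ∑[ u < n ] ⟦ out v u ⟧ ≤ d) →
  (∀ v u b → out v u ≡ true → b ≢ u → 1 ≤ ⟦ out v b ⟧ + ⟦ out u b ⟧ → agreement (W u) (W b) ≤ A) →
  (d + d) * (A + d) < s →
  ∃ λ (I : Fin n → Fin n → Fin s) → ∀ v u → out v u ≡ true →
    ∀ b → 1 ≤ ⟦ out v b ⟧ + ⟦ out u b ⟧ →
    (b ≢ u → W u (I v u) ≢ W b (I v u)) ×
    (∀ c → out b c ≡ true → I v u ≢ I b c)
positions {n} {s} d A out r W out-decreases out≤d agree s-large =
  let I , chosen = greedy r P (λ _ → i₀) step
  in I , λ v u v→u → result I v (chosen v) u v→u
  where
  open ≤-Reasoning
  -- A placeholder, used before the choice is made and on pairs that are no edges.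
  i₀ : Fin s
  i₀ = first s {{>-nonZero (≤-<-trans z≤n s-large)}}

  -- Counted with multiplicity, so that the sum over `b` is exactly a sum of two out-degrees.
  near : Fin n → Fin n → Fin n → ℕ
  near v u b = ⟦ out v b ⟧ + ⟦ out u b ⟧

  P : Fin n → (Fin n → Fin n → Fin s) → (Fin n → Fin s) → Set
  P v g p = ∀ u → out v u ≡ true → ∀ b → 1 ≤ near v u b →
    (b ≢ u → W u (p u) ≢ W b (p u)) × (∀ c → out b c ≡ true → p u ≢ g b c)

  module _ (v : Fin n) (g : Fin n → Fin n → Fin s) (u : Fin n) where
    same used : Fin n → Fin s → ℕ
    -- The first factor drops `b = u`, whose word agrees with `W u` everywhere.
    same b i = ⟦ not (does (b ≟ u)) ⟧ * ⟦ does (W u i ≟ W b i) ⟧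
    used b i = ∑[ c < n ] (⟦ out b c ⟧ * ⟦ does (i ≟ g b c) ⟧)

    -- A weighted count of the constraints violated at position `i`; `∃-zero` finds a position where
    -- it vanishes.
    bad : Fin s → ℕ
    bad i = ∑[ b < n ] (near v u b * (same b i + used b i))

    sum-used : ∀ b → sum (used b) ≤ d
    sum-used b = begin
      ∑[ i < s ] ∑[ c < n ] (⟦ out b c ⟧ * ⟦ does (i ≟ g b c) ⟧)  ≡⟨ ∑-comm (λ i c → ⟦ out b c ⟧ * ⟦ does (i ≟ g b c) ⟧) ⟩
      ∑[ c < n ] ∑[ i < s ] (⟦ out b c ⟧ * ⟦ does (i ≟ g b c) ⟧)  ≡⟨ sum-cong-≗ (λ c → sym (*-distribˡ-sum ⟦ out b c ⟧ (λ i → ⟦ does (i ≟ g b c) ⟧))) ⟩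
      ∑[ c < n ] (⟦ out b c ⟧ * ∑[ i < s ] ⟦ does (i ≟ g b c) ⟧)  ≡⟨ sum-cong-≗ (λ c → trans (cong (⟦ out b c ⟧ *_) (sum-indicator (g b c))) (*-identityʳ _)) ⟩
      ∑[ c < n ] ⟦ out b c ⟧                                      ≤⟨ out≤d b ⟩
      d                                                           ∎

    sum-same : out v u ≡ true → ∀ b → 1 ≤ near v u b → sum (same b) ≤ A
    sum-same v→u b 1≤near with b ≟ u
    ... | yes _   = ≤-trans (≤-reflexive (sum-zero s)) z≤n
    ... | no  b≢u = ≤-trans (≤-reflexive (sum-cong-≗ (λ i → *-identityˡ ⟦ does (W u i ≟ W b i) ⟧))) (agree v u b v→u b≢u 1≤near)

    term : out v u ≡ true → ∀ b →
      ∑[ i < s ] (near v u b * (same b i + used b i)) ≤ near v u b * (A + d)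
    term v→u b = begin
      ∑[ i < s ] (near v u b * (same b i + used b i))   ≡⟨ sym (*-distribˡ-sum (near v u b) (λ i → same b i + used b i)) ⟩
      near v u b * ∑[ i < s ] (same b i + used b i)     ≡⟨ cong (near v u b *_) (∑-distrib-+ (same b) (used b)) ⟩
      -- The agreement bound is available for `b` of positive weight; at weight 0 both sides vanish.
      near v u b * (sum (same b) + sum (used b))        ≤⟨ scaled (near v u b) (λ 1≤near → +-mono-≤ (sum-same v→u b 1≤near) (sum-used b)) ⟩
      near v u b * (A + d)                              ∎
      where
      scaled : ∀ h {x y} → (1 ≤ h → x ≤ y) → h * x ≤ h * y
      scaled zero    _   = z≤n
      scaled (suc h) x≤y = *-monoʳ-≤ (suc h) (x≤y (s≤s z≤n))

    sum-bad : out v u ≡ true → sum bad < s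
    sum-bad v→u = begin-strict
      ∑[ i < s ] ∑[ b < n ] (near v u b * (same b i + used b i))    ≡⟨ ∑-comm (λ i b → near v u b * (same b i + used b i)) ⟩
      ∑[ b < n ] ∑[ i < s ] (near v u b * (same b i + used b i))    ≤⟨ sum-mono (term v→u) ⟩
      ∑[ b < n ] (near v u b * (A + d))                             ≡⟨ sym (*-distribʳ-sum (A + d) (near v u)) ⟩
      ∑[ b < n ] near v u b * (A + d)                               ≡⟨ cong (_* (A + d)) (∑-distrib-+ (λ b → ⟦ out v b ⟧) (λ b → ⟦ out u b ⟧)) ⟩
      (∑[ b < n ] ⟦ out v b ⟧ + ∑[ b < n ] ⟦ out u b ⟧) * (A + d)   ≤⟨ *-monoˡ-≤ (A + d) (+-mono-≤ (out≤d v) (out≤d u)) ⟩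
      (d + d) * (A + d)                                             <⟨ s-large ⟩
      s                                                             ∎

    good : ∀ i → bad i ≡ 0 → ∀ b → 1 ≤ near v u b →
      (b ≢ u → W u i ≢ W b i) × (∀ c → out b c ≡ true → i ≢ g b c)
    good i bad≡0 b 1≤near = not-same , not-used
      where
      vanish : same b i + used b i ≡ 0
      vanish = n≤0⇒n≡0 (begin
        same b i + used b i                   ≤⟨ m≤n*m _ (near v u b) {{>-nonZero 1≤near}} ⟩
        near v u b * (same b i + used b i)    ≤⟨ term≤sum (λ b → near v u b * (same b i + used b i)) b ⟩
        bad i                                 ≡⟨ bad≡0 ⟩
        0                                     ∎)
      not-same : b ≢ u → W u i ≢ W b i
      not-same b≢u eq with m+n≡0⇒m≡0 (same b i) vanish
      ... | same≡0 rewrite dec-false (b ≟ u) b≢u | dec-true (W u i ≟ W b i) eq = contradiction same≡0 λ ()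
      not-used : ∀ c → out b c ≡ true → i ≢ g b c
      not-used c b→c eq = contradiction (begin
        1                                          ≡⟨ cong₂ _*_ (cong ⟦_⟧ (sym b→c)) (cong ⟦_⟧ (sym (dec-true (i ≟ g b c) eq))) ⟩
        ⟦ out b c ⟧ * ⟦ does (i ≟ g b c) ⟧         ≤⟨ term≤sum (λ c → ⟦ out b c ⟧ * ⟦ does (i ≟ g b c) ⟧) c ⟩
        used b i                                   ≡⟨ m+n≡0⇒n≡0 (same b i) vanish ⟩
        0                                          ∎) λ ()

  choose : ∀ v g u → ∃ λ i → out v u ≡ true → ∀ b → 1 ≤ near v u b →
    (b ≢ u → W u i ≢ W b i) × (∀ c → out b c ≡ true → i ≢ g b c)
  choose v g u with out v u Bool.≟ true
  ... | no  v↛u = i₀ , λ v→u → contradiction v→u v↛u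
  ... | yes v→u = let i , bad≡0 = ∃-zero (bad v g u) (sum-bad v g u v→u) in i , λ _ → good v g u i bad≡0

  step : ∀ v g → ∃ (P v g)
  step v g = (λ u → proj₁ (choose v g u)) , λ u → proj₂ (choose v g u)

  -- Arcs lower the rank, so `b` lies one or two arcs below `v`. Hence its positions are final when
  -- those of `v` are chosen.
  near-below : ∀ {v u b} → out v u ≡ true → 1 ≤ near v u b → r b < r v
  near-below {v} {u} {b} v→u 1≤near with out v b in v?b | out u b in u?b
  ... | true  | _     = out-decreases v b v?b
  ... | false | true  = <-trans (out-decreases u b u?b) (out-decreases v u v→u)
  ... | false | false = contradiction 1≤near λ ()

  result : ∀ I v → (∃ λ g → (∀ u → r u < r v → g u ≡ I u) × P v g (I v)) → ∀ u → out v u ≡ true →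
    ∀ b → 1 ≤ near v u b →
    (b ≢ u → W u (I v u) ≢ W b (I v u)) × (∀ c → out b c ≡ true → I v u ≢ I b c)
  result I v (g , g≡I , p) u v→u b 1≤near =
    proj₁ (p u v→u b 1≤near) ,
    λ c b→c → subst (λ h → I v u ≢ h c) (g≡I b (near-below {v} {u} v→u 1≤near)) (proj₂ (p u v→u b 1≤near) c b→c)

-- Powers of two and the binary logarithm.

2^-cancel-≤ : ∀ {x y} → 2 ^ x ≤ 2 ^ y → x ≤ y
2^-cancel-≤ {x} {y} 2^x≤2^y with x ≤? y
... | yes x≤y = x≤y
... | no  x≰y = contradiction (^-monoʳ-< 2 (s≤s (s≤s z≤n)) (≰⇒> x≰y)) (≤⇒≯ 2^x≤2^y)

1+n≤2^n : ∀ n → suc n ≤ 2 ^ n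
1+n≤2^n zero    = ≤-refl
1+n≤2^n (suc n) = begin
  1 + suc n             ≤⟨ +-mono-≤ (m^n>0 2 n) (1+n≤2^n n) ⟩
  2 ^ n + 2 ^ n         ≡⟨ cong (2 ^ n +_) (sym (+-identityʳ (2 ^ n))) ⟩
  2 ^ suc n             ∎
  where open ≤-Reasoning

-- Otherwise monotonicity of the logarithm would put `suc ⌊log₂ n ⌋` below `⌊log₂ n ⌋`.
n<2^[1+⌊log₂n⌋] : ∀ n → n < 2 ^ suc ⌊log₂ n ⌋
n<2^[1+⌊log₂n⌋] n with n <? 2 ^ suc ⌊log₂ n ⌋
... | yes n<2^ = n<2^
... | no  n≮2^ = contradiction (begin-strict
  ⌊log₂ n ⌋                      <⟨ ≤-refl ⟩
  suc ⌊log₂ n ⌋                  ≡⟨ sym (⌊log₂[2^n]⌋≡n (suc ⌊log₂ n ⌋)) ⟩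
  ⌊log₂ 2 ^ suc ⌊log₂ n ⌋ ⌋      ≤⟨ ⌊log₂⌋-mono-≤ (≮⇒≥ n≮2^) ⟩
  ⌊log₂ n ⌋                      ∎) (<-irrefl refl)
  where open ≤-Reasoning

-- Orientation towards lower rank and the edge-colouring.

module _ (G : Graph) (r : Fin (n G) → ℕ) where

  out : Fin (n G) → Fin (n G) → Bool
  out v u = adj G v u ∧ does (r u <? r v)

  infix 4 _⇒_
  _⇒_ : Fin (n G) → Fin (n G) → Set
  v ⇒ u = out v u ≡ true

  ⇒-adj : ∀ v u → v ⇒ u → Adj G v u
  ⇒-adj v u v⇒u = proj₁ (∧-true⇒ _ _ v⇒u)

  ⇒-decreases : ∀ v u → v ⇒ u → r u < r v
  ⇒-decreases v u v⇒u = does-true⇒ (r u <? r v) (proj₂ (∧-true⇒ (adj G v u) _ v⇒u))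

  adj-⇒ : ∀ v u → Adj G v u → r u < r v → v ⇒ u
  adj-⇒ v u vu u<v rewrite vu = dec-true (r u <? r v) u<v

  adj-sym : ∀ {u v} → Adj G u v → Adj G v u
  adj-sym {u} {v} uv = trans (Graph.sym G v u) uv

  module _ (r-proper : ∀ u v → Adj G u v → r u ≢ r v) where

    orient : ∀ u v → Adj G u v → u ⇒ v ⊎ v ⇒ u
    orient u v uv with <-cmp (r u) (r v)
    ... | tri< u<v _ _ = inj₂ (adj-⇒ v u (adj-sym uv) u<v)
    ... | tri≈ _ eq _  = contradiction eq (r-proper u v uv)
    ... | tri> _ _ v<u = inj₁ (adj-⇒ u v uv v<u)

    module _ {s q} (W : Fin (n G) → Fin s → Fin q) (I : Fin (n G) → Fin (n G) → Fin s)
      (proper : ∀ v u → v ⇒ u → ∀ b → 1 ≤ ⟦ out v b ⟧ + ⟦ out u b ⟧ →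
        (b ≢ u → W u (I v u) ≢ W b (I v u)) × (∀ c → b ⇒ c → I v u ≢ I b c)) where

      colour : Fin (n G) → Fin (n G) → Fin (s * q)
      colour v u = combine (I v u) (W u (I v u))

      nearˡ : ∀ {v u b} → v ⇒ b → 1 ≤ ⟦ out v b ⟧ + ⟦ out u b ⟧
      nearˡ v⇒b = ≤-trans (⟦⟧-true v⇒b) (m≤m+n _ _)

      nearʳ : ∀ {v u b} → u ⇒ b → 1 ≤ ⟦ out v b ⟧ + ⟦ out u b ⟧
      nearʳ {v} {u} {b} u⇒b = ≤-trans (⟦⟧-true u⇒b) (m≤n+m _ ⟦ out v b ⟧)

      module _ {v u x y} (v⇒u : v ⇒ u) (x⇒y : x ⇒ y) (same : colour v u ≡ colour x y) where

        same-position : I v u ≡ I x y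
        same-position = proj₁ (combine-injective (I v u) _ (I x y) _ same)

        same-letter : W u (I v u) ≡ W y (I v u)
        same-letter = trans (proj₂ (combine-injective (I v u) _ (I x y) _ same)) (cong (W y) (sym same-position))

        -- An arc from `v` or `u` into `x` makes `x` one of the vertices whose out-edges must avoid
        -- the position `I v u`.
        ¬tail⇒tail : ¬ v ⇒ x
        ¬tail⇒tail v⇒x = proj₂ (proper v u v⇒u x (nearˡ {v} {u} v⇒x)) y x⇒y same-position

        ¬head⇒tail : ¬ u ⇒ x
        ¬head⇒tail u⇒x = proj₂ (proper v u v⇒u x (nearʳ {v} {u} u⇒x)) y x⇒y same-position

        -- Equal colours force equal letters of `W u` and `W y` at a position where `proper`
        -- separates them.
        ¬head⇒head : ¬ u ⇒ y
        ¬head⇒head u⇒y = proj₁ (proper v u v⇒u y (nearʳ {v} {u} u⇒y))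
          (λ { refl → <-irrefl refl (⇒-decreases u u u⇒y) }) same-letter

        -- The letters can coincide if both edges share their head; the joining arc is then the edge
        -- from `v` to `u` itself, not a third edge.
        tail⇒head : v ⇒ y → y ≡ u
        tail⇒head v⇒y with y ≟ u
        ... | yes y≡u = y≡u
        ... | no  y≢u = contradiction same-letter (proj₁ (proper v u v⇒u y (nearˡ {v} {u} v⇒y)) y≢u)

      -- Eight cases, by the endpoints joined and the direction of the joining arc. Arcs from the
      -- second edge to the first are handled by exchanging the two edges, and the tail-to-head
      -- cases survive with the joining edge equal to one of the two.
      injective-directed : ∀ v u x y a b → v ⇒ u → x ⇒ y → colour v u ≡ colour x y →
        Endpoint a v u → Endpoint b x y → Adj G a b → SameEdge a b v u ⊎ SameEdge a b x y
      injective-directed v u x y a b v⇒u x⇒y same (inj₁ refl) (inj₁ refl) ab with orient a b ab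
      ... | inj₁ a⇒b = contradiction a⇒b (¬tail⇒tail v⇒u x⇒y same)
      ... | inj₂ b⇒a = contradiction b⇒a (¬tail⇒tail x⇒y v⇒u (sym same))
      injective-directed v u x y a b v⇒u x⇒y same (inj₁ refl) (inj₂ refl) ab with orient a b ab
      ... | inj₁ a⇒b = inj₁ (inj₁ (refl , tail⇒head v⇒u x⇒y same a⇒b))
      ... | inj₂ b⇒a = contradiction b⇒a (¬head⇒tail x⇒y v⇒u (sym same))
      injective-directed v u x y a b v⇒u x⇒y same (inj₂ refl) (inj₁ refl) ab with orient a b ab
      ... | inj₁ a⇒b = contradiction a⇒b (¬head⇒tail v⇒u x⇒y same)
      ... | inj₂ b⇒a = inj₂ (inj₂ (tail⇒head x⇒y v⇒u (sym same) b⇒a , refl))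
      injective-directed v u x y a b v⇒u x⇒y same (inj₂ refl) (inj₂ refl) ab with orient a b ab
      ... | inj₁ a⇒b = contradiction a⇒b (¬head⇒head v⇒u x⇒y same)
      ... | inj₂ b⇒a = contradiction b⇒a (¬head⇒head x⇒y v⇒u (sym same))

      -- Reading the colour along the orientation makes `ψ` symmetric on edges, and `suc` shifts the
      -- colours to start at 1.
      ψ : Fin (n G) → Fin (n G) → ℕ
      ψ u v = suc (toℕ (if out u v then colour u v else colour v u))

      ψ-forward : ∀ {u v} → u ⇒ v → ψ u v ≡ suc (toℕ (colour u v))
      ψ-forward u⇒v rewrite u⇒v = refl

      ψ-backward : ∀ {u v} → v ⇒ u → ψ u v ≡ suc (toℕ (colour v u))
      ψ-backward {u} {v} v⇒u
        rewrite ≢true⇒≡false (out u v) (λ u⇒v → <-asym (⇒-decreases u v u⇒v) (⇒-decreases v u v⇒u)) = refl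

      ψ-sym : ∀ u v → Adj G u v → ψ u v ≡ ψ v u
      ψ-sym u v uv with orient u v uv
      ... | inj₁ u⇒v = trans (ψ-forward u⇒v) (sym (ψ-backward u⇒v))
      ... | inj₂ v⇒u = trans (ψ-backward v⇒u) (sym (ψ-forward v⇒u))

      injective-forward : ∀ v u x y a b → v ⇒ u → x ⇒ y → ψ v u ≡ ψ x y →
        Endpoint a v u → Endpoint b x y → Adj G a b → SameEdge a b v u ⊎ SameEdge a b x y
      injective-forward v u x y a b v⇒u x⇒y same = injective-directed v u x y a b v⇒u x⇒y
        (toℕ-injective (suc-injective (trans (sym (ψ-forward v⇒u)) (trans same (ψ-forward x⇒y)))))

      injective-edge-colouring : IsInjectiveEdgeColoring G ψ
      injective-edge-colouring = ψ-sym , injective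
        where
        injective : ∀ u v x y a b → Adj G u v → Adj G x y → ¬ SameEdge u v x y →
          ψ u v ≡ ψ x y → Endpoint a u v → Endpoint b x y → Adj G a b →
          SameEdge a b u v ⊎ SameEdge a b x y
        -- Each edge is turned to agree with its orientation, which swaps its endpoints in the
        -- conclusion.
        injective u v x y a b uv xy _ same a∈uv b∈xy ab with orient u v uv | orient x y xy
        ... | inj₁ u⇒v | inj₁ x⇒y = injective-forward u v x y a b u⇒v x⇒y same a∈uv b∈xy ab
        ... | inj₁ u⇒v | inj₂ y⇒x = Sum.map₂ Sum.swap
          (injective-forward u v y x a b u⇒v y⇒x (trans same (ψ-sym x y xy)) a∈uv (Sum.swap b∈xy) ab)
        ... | inj₂ v⇒u | inj₁ x⇒y = Sum.map₁ Sum.swap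
          (injective-forward v u x y a b v⇒u x⇒y (trans (sym (ψ-sym u v uv)) same) (Sum.swap a∈uv) b∈xy ab)
        ... | inj₂ v⇒u | inj₂ y⇒x = Sum.map Sum.swap Sum.swap
          (injective-forward v u y x a b v⇒u y⇒x (trans (sym (ψ-sym u v uv)) (trans same (ψ-sym x y xy)))
            (Sum.swap a∈uv) (Sum.swap b∈xy) ab)

      coloured : InjChromIndexAtMost G (s * q)
      coloured = ψ , injective-edge-colouring , λ u v _ → s≤s z≤n , toℕ<n _

  -- Counting the pairs whose words are compared.

  module _ {d Δ} (out≤d : ∀ v → ∑[ u < n G ] ⟦ out v u ⟧ ≤ d) (degree≤Δ : ∀ v → degree G v ≤ Δ) where
    open ≤-Reasoning

    -- The last sum counts common in-neighbours. The weight is symmetric, as the greedy choice of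
    -- words requires.
    related : Fin (n G) → Fin (n G) → ℕ
    related u v = ⟦ out u v ⟧ + ⟦ out v u ⟧ + ∑[ x < n G ] (⟦ out x u ⟧ * ⟦ out x v ⟧)

    related-sym : ∀ u v → related u v ≡ related v u
    related-sym u v = cong₂ _+_ (+-comm ⟦ out u v ⟧ ⟦ out v u ⟧)
      (sum-cong-≗ λ x → *-comm ⟦ out x u ⟧ ⟦ out x v ⟧)

    in≤Δ : ∀ v → ∑[ u < n G ] ⟦ out u v ⟧ ≤ Δ
    in≤Δ v = begin
      ∑[ u < n G ] ⟦ out u v ⟧   ≤⟨ sum-mono (λ u → ⟦⟧-mono (out u v) (adj G v u) (λ u⇒v → adj-sym (⇒-adj u v u⇒v))) ⟩
      ∑[ u < n G ] ⟦ adj G v u ⟧ ≡⟨ sym (count≡sum (adj G v)) ⟩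
      degree G v                 ≤⟨ degree≤Δ v ⟩
      Δ                          ∎

    -- The term `Δ * d` arises because `u` has at most `Δ` in-neighbours, each with at most `d`
    -- out-neighbours.
    sum-related : ∀ u → sum (related u) ≤ (d + Δ) + Δ * d
    sum-related u = begin
      sum (related u)
        ≡⟨ ∑-distrib-+ (λ v → ⟦ out u v ⟧ + ⟦ out v u ⟧) (λ v → ∑[ x < n G ] (⟦ out x u ⟧ * ⟦ out x v ⟧)) ⟩
      ∑[ v < n G ] (⟦ out u v ⟧ + ⟦ out v u ⟧) + ∑[ v < n G ] ∑[ x < n G ] (⟦ out x u ⟧ * ⟦ out x v ⟧)
        ≤⟨ +-mono-≤ adjacent siblings ⟩
      (d + Δ) + Δ * d ∎
      where
      adjacent : ∑[ v < n G ] (⟦ out u v ⟧ + ⟦ out v u ⟧) ≤ d + Δ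
      adjacent = ≤-trans (≤-reflexive (∑-distrib-+ (λ v → ⟦ out u v ⟧) (λ v → ⟦ out v u ⟧)))
        (+-mono-≤ (out≤d u) (in≤Δ u))
      siblings : ∑[ v < n G ] ∑[ x < n G ] (⟦ out x u ⟧ * ⟦ out x v ⟧) ≤ Δ * d
      siblings = begin
        ∑[ v < n G ] ∑[ x < n G ] (⟦ out x u ⟧ * ⟦ out x v ⟧)  ≡⟨ ∑-comm (λ v x → ⟦ out x u ⟧ * ⟦ out x v ⟧) ⟩
        ∑[ x < n G ] ∑[ v < n G ] (⟦ out x u ⟧ * ⟦ out x v ⟧)  ≡⟨ sum-cong-≗ (λ x → sym (*-distribˡ-sum ⟦ out x u ⟧ (λ v → ⟦ out x v ⟧))) ⟩
        ∑[ x < n G ] (⟦ out x u ⟧ * ∑[ v < n G ] ⟦ out x v ⟧)  ≤⟨ sum-mono (λ x → *-monoʳ-≤ ⟦ out x u ⟧ (out≤d x)) ⟩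
        ∑[ x < n G ] (⟦ out x u ⟧ * d)                         ≡⟨ sym (*-distribʳ-sum d (λ x → ⟦ out x u ⟧)) ⟩
        ∑[ x < n G ] ⟦ out x u ⟧ * d                           ≤⟨ *-monoˡ-≤ d (in≤Δ u) ⟩
        Δ * d                                                  ∎

    near⇒related : ∀ v u b → v ⇒ u → 1 ≤ ⟦ out v b ⟧ + ⟦ out u b ⟧ → 1 ≤ related u b
    near⇒related v u b v⇒u 1≤near with out v b in v?b | out u b
    ... | _     | true  = s≤s z≤n
    ... | false | false = contradiction 1≤near λ ()
    -- Here `v` is a common in-neighbour of `u` and `b`.
    ... | true  | false = begin
      1                                              ≡⟨ cong₂ (λ p q → ⟦ p ⟧ * ⟦ q ⟧) (sym v⇒u) (sym v?b) ⟩
      ⟦ out v u ⟧ * ⟦ out v b ⟧                      ≤⟨ term≤sum (λ x → ⟦ out x u ⟧ * ⟦ out x b ⟧) v ⟩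
      ∑[ x < n G ] (⟦ out x u ⟧ * ⟦ out x b ⟧)       ≤⟨ m≤n+m _ ⟦ out b u ⟧ ⟩
      ⟦ out b u ⟧ + ∑[ x < n G ] (⟦ out x u ⟧ * ⟦ out x b ⟧) ∎

    -- The sum is at most (Δ + 1)(d + 1). A power of two as the bound lets the number of agreements
    -- be read off by comparing exponents.
    related-few : ∀ {L} → Δ < 2 ^ suc L → (d + Δ) + Δ * d ≤ 2 ^ (suc L + d)
    related-few {L} Δ<2^ = begin
      (d + Δ) + Δ * d             ≡⟨ lemma d Δ ⟩
      d + Δ * suc d               ≤⟨ +-monoˡ-≤ (Δ * suc d) (n≤1+n d) ⟩
      suc Δ * suc d               ≤⟨ *-mono-≤ Δ<2^ (1+n≤2^n d) ⟩
      2 ^ suc L * 2 ^ d           ≡⟨ sym (^-distribˡ-+-* 2 (suc L) d) ⟩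
      2 ^ (suc L + d)             ∎
      where
      lemma : ∀ d Δ → (d + Δ) + Δ * d ≡ d + Δ * suc d
      lemma = solve-∀

-- Parameters and the final bound.

module _ d L (1≤d : 1 ≤ d) (1≤L : 1 ≤ L) where
  private
    m t s : ℕ
    -- With x = d L, at most 2x + (1 + L) + d ≤ 5x agreements occur, so at most 2d · 6x positions
    -- are excluded, while `s` is 2d · 8x. The alphabet has 16 d letters, giving 16 d² L · 16 d
    -- colours.
    m = 8 * d
    t = 2 * (d * L)
    s = m * t
    instance
      d≢0 : NonZero d
      d≢0 = >-nonZero 1≤d
      L≢0 : NonZero L
      L≢0 = >-nonZero 1≤L

  positions-suffice : (d + d) * ((t + (suc L + d)) + d) < s
  positions-suffice = begin-strict
    (d + d) * ((t + (suc L + d)) + d)  ≤⟨ *-monoʳ-≤ (d + d) (+-mono-≤ (+-monoʳ-≤ t (+-mono-≤ (+-mono-≤ 1≤x L≤x) d≤x)) d≤x) ⟩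
    (d + d) * ((t + ((x + x) + x)) + x)  ≡⟨ cong ((d + d) *_) (lemma₁ x) ⟩
    -- `m≤m+n 7 1` is the inequality 6 < 8; strictness also needs `d` and `x` positive.
    (d + d) * (6 * x)                  <⟨ *-monoʳ-< (d + d) {{m+m≢0 d}} (*-monoˡ-< x {{>-nonZero 1≤x}} (m≤m+n 7 1)) ⟩
    (d + d) * (8 * x)                  ≡⟨ lemma₂ d x ⟩
    s                                  ∎
    where
    open ≤-Reasoning
    x = d * L
    1≤x : 1 ≤ x
    1≤x = *-mono-≤ 1≤d 1≤L
    L≤x : L ≤ x
    L≤x = m≤n*m L d
    d≤x : d ≤ x
    d≤x = m≤m*n d L
    lemma₁ : ∀ x → (2 * x + ((x + x) + x)) + x ≡ 6 * x
    lemma₁ = solve-∀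
    lemma₂ : ∀ d x → (d + d) * (8 * x) ≡ (8 * d) * (2 * x)
    lemma₂ = solve-∀

  colour-count : s * (m + m) ≡ 256 * d ^ 3 * L
  colour-count = lemma d L
    where
    lemma : ∀ d L → (8 * d) * (2 * (d * L)) * (8 * d + 8 * d) ≡ 256 * (d * (d * (d * 1))) * L
    lemma = solve-∀

  injective-index-bound : ∀ {Δ} (G : Graph) → Δ < 2 ^ suc L → Degenerate d G → (∀ v → degree G v ≤ Δ) →
    InjChromIndexAtMost G (256 * d ^ 3 * L)
  injective-index-bound {Δ} G Δ<2^ degenerate degree≤Δ =
    let r , r-ordering = ordering-on G degenerate (count everything) everything ≤-refl
        r-proper , out≤d = directed r r-ordering
        W , few = ∃-words-few-agreements m t ((d + Δ) + Δ * d) {{m*n≢0 8 d}}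
                    (related G r out≤d degree≤Δ) (related-sym G r out≤d degree≤Δ) (sum-related G r out≤d degree≤Δ)
        I , proper = positions d (t + (suc L + d)) (out G r) r W (⇒-decreases G r) out≤d
                       -- The agreement bound `t + (suc L + d)` is the exponent of the potential
                       -- bound `2 ^ t` times the bound on the total weight.
                       (λ v u b v⇒u b≢u near → 2^-cancel-≤ (begin
                         2 ^ agreement (W u) (W b)     ≤⟨ few u b (b≢u ∘ sym) (near⇒related G r out≤d degree≤Δ v u b v⇒u near) ⟩
                         2 ^ t * ((d + Δ) + Δ * d)     ≤⟨ *-monoʳ-≤ (2 ^ t) (related-few G r out≤d degree≤Δ {L} Δ<2^) ⟩
                         2 ^ t * 2 ^ (suc L + d)       ≡⟨ sym (^-distribˡ-+-* 2 t (suc L + d)) ⟩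
                         2 ^ (t + (suc L + d))         ∎))
                       positions-suffice
    in subst (InjChromIndexAtMost G) colour-count (coloured G r r-proper W I proper)
    where
    open ≤-Reasoning
    everything : Fin (n G) → Bool
    everything _ = true
    directed : ∀ r → IsOrdering G degenerate (count everything) everything r →
      (∀ u v → Adj G u v → r u ≢ r v) × (∀ v → ∑[ u < n G ] ⟦ out G r v u ⟧ ≤ d)
    directed r r-ordering = r-proper , λ v → ≤-trans (≤-reflexive (sym (count≡sum (out G r v))))
        (outdegree v refl (out G r v) (λ u v⇒u → refl , ⇒-adj G r v u v⇒u , ⇒-decreases G r v u v⇒u))
      where
      open IsOrdering r-ordering
      r-proper : ∀ u v → Adj G u v → r u ≢ r v
      r-proper u v uv eq with injective u v refl refl eq
      ... | refl = contradiction (trans (sym uv) (irrefl G u)) λ ()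

theorem1p4 : Σ ℕ λ C → 0 < C ×
    ((d Δ : ℕ) → 1 ≤ d → 2 ≤ Δ → (G : Graph) → Degenerate d G → MaxDegree G Δ →
    InjChromIndexAtMost G (C * d ^ 3 * ⌊log₂ Δ ⌋))
-- Since `⌊log₂ Δ ⌋` is at most log Δ / log 2, this gives C = 256 / log 2 for the natural logarithm.
-- From `2 ≤ Δ` comes `1 ≤ ⌊log₂ Δ ⌋`.
theorem1p4 = 256 , s≤s z≤n , λ d Δ 1≤d 2≤Δ G degenerate (degree≤Δ , _) →
  injective-index-bound d ⌊log₂ Δ ⌋ 1≤d (⌊log₂⌋-mono-≤ 2≤Δ) G (n<2^[1+⌊log₂n⌋] Δ) degenerate degree≤Δ
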